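{- The resolving total domination number of the fractal cubic network $FCN(1)$ is $\gamma_{rt}(FCN(1)) = 8$.
   Context: Fractal cubic network: for an integer $l\ge 0$, $FCN(l)$ is the finite simple graph whose vertices are all binary strings of length $2l+2$, defined recursively as follows. $FCN(0)$ is the 4-cycle with vertices $00, 01, 11, 10$ in this cyclic order. For $l\ge 1$, $FCN(l)$ is obtained from the disjoint union of the four copies $ab\,\Vert\,FCN(l-1)$, $a,b\in\{0,1\}$ (each vertex string of $FCN(l-1)$ is prefixed by $ab$, adjacency inside a copy being that of $FCN(l-1)$), by adding the four edges $\{00w,10w\}$, $\{10w,11w\}$, $\{11w,01w\}$, $\{01w,00w\}$, where $w=10(01)^{l-1}$ is the string $10$ followed by $l-1$ repetitions of $01$. A set $R\subseteq V(\Gamma)$ of a connected graph $\Gamma$ is a resolving set if for every two distinct vertices $g,h$ there is $r\in R$ with $d(g,r)\ne d(h,r)$ (graph distance). A total dominating set is a set $D\subseteq V(\Gamma)$ such that every vertex of $\Gamma$ (including those in $D$) is adjacent to some vertex of $D$. A resolving total dominating set is a set that is both a resolving set and a total dominating set; $\gamma_{rt}(\Gamma)$ is the minimum size of such a set. -}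

module Defs where

open import Data.Digit using (Bit; 0b; 1b)
open import Data.List.Base using (List; length)
open import Data.List.Membership.Propositional using (_∈_)
open import Data.List.Relation.Unary.Unique.Propositional using (Unique)
open import Data.Nat.Base using (ℕ; suc; _+_; _*_; _≤_)
open import Data.Product.Base using (_×_; ∃-syntax)
open import Data.Vec.Base using (Vec; []; _∷_; concat; replicate)
open import Level using (0ℓ)
open import Relation.Binary.Construct.Closure.Symmetric
  using (SymClosure; fwd; bwd; symmetric)
open import Relation.Binary.Core using (Rel)
open import Relation.Binary.Definitions using (Symmetric)
open import Relation.Binary.PropositionalEquality.Core using (_≡_; _≢_; refl)
open import Relation.Nullary.Negation.Core using (¬_)

record SimpleGraph : Set₁ where
  field
    Vertex     : Set
    Adj        : Rel Vertex 0ℓ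
    adj-sym    : Symmetric Adj
    adj-irrefl : ∀ {v} → ¬ Adj v v

module _ (Γ : SimpleGraph) where
  open SimpleGraph Γ

  data Walk : Vertex → Vertex → ℕ → Set where
    []  : ∀ {u} → Walk u u 0
    _∷_ : ∀ {u v w n} → Adj u v → Walk v w n → Walk u w (suc n)

  -- Distance as a relation: IsDistance u v n says that d(u,v) = n.
  -- It is single-valued, and on a connected finite graph it is also total.
  IsDistance : Vertex → Vertex → ℕ → Set
  IsDistance u v n = Walk u v n × (∀ {m} → Walk u v m → n ≤ m)

  -- A finite vertex set is a list R with Unique R, of cardinality length R.

  -- The existential over m and n reads d(g,r) ≠ d(h,r); it is the usual
  -- notion for connected graphs, where both distances exist.
  IsResolving : List Vertex → Set
  IsResolving R = ∀ {g h} → g ≢ h →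
    ∃[ r ] r ∈ R × ∃[ m ] ∃[ n ] IsDistance g r m × IsDistance h r n × m ≢ n

  IsTotalDominating : List Vertex → Set
  IsTotalDominating D = ∀ v → ∃[ u ] u ∈ D × Adj v u

  IsResolvingTotalDominating : List Vertex → Set
  IsResolvingTotalDominating R = IsResolving R × IsTotalDominating R

  -- γ_rt(Γ) = n
  IsResolvingTotalDominationNumber : ℕ → Set
  IsResolvingTotalDominationNumber n =
    (∃[ R ] Unique R × IsResolvingTotalDominating R × length R ≡ n) ×
    (∀ R → Unique R → IsResolvingTotalDominating R → n ≤ length R)

-- The length is written so that String (suc l) is definitionally
-- Vec Bit (2 + (2 + l * 2)), i.e. two bits in front of a String l.
String : ℕ → Set
String l = Vec Bit (2 + l * 2)

-- 10(01)^l, the vertex of FCN l at which its four copies are joined in FCN (suc l)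
port : ∀ l → String l
port l = 1b ∷ 0b ∷ concat (replicate l (0b ∷ 1b ∷ []))

-- Every edge is listed in one orientation; adjacency is the symmetric closure.
data Edge : ∀ l → Rel (String l) 0ℓ where
  00-01 : Edge 0 (0b ∷ 0b ∷ []) (0b ∷ 1b ∷ [])
  01-11 : Edge 0 (0b ∷ 1b ∷ []) (1b ∷ 1b ∷ [])
  11-10 : Edge 0 (1b ∷ 1b ∷ []) (1b ∷ 0b ∷ [])
  10-00 : Edge 0 (1b ∷ 0b ∷ []) (0b ∷ 0b ∷ [])
  copy  : ∀ {l u v} a b → Edge l u v → Edge (suc l) (a ∷ b ∷ u) (a ∷ b ∷ v)
  00w-10w : ∀ {l} → Edge (suc l) (0b ∷ 0b ∷ port l) (1b ∷ 0b ∷ port l)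
  10w-11w : ∀ {l} → Edge (suc l) (1b ∷ 0b ∷ port l) (1b ∷ 1b ∷ port l)
  11w-01w : ∀ {l} → Edge (suc l) (1b ∷ 1b ∷ port l) (0b ∷ 1b ∷ port l)
  01w-00w : ∀ {l} → Edge (suc l) (0b ∷ 1b ∷ port l) (0b ∷ 0b ∷ port l)

edge⇒≢ : ∀ {l u v} → Edge l u v → u ≢ v
edge⇒≢ 00-01 ()
edge⇒≢ 01-11 ()
edge⇒≢ 11-10 ()
edge⇒≢ 10-00 ()
edge⇒≢ (copy a b e) refl = edge⇒≢ e refl
edge⇒≢ 00w-10w ()
edge⇒≢ 10w-11w ()
edge⇒≢ 11w-01w ()
edge⇒≢ 01w-00w ()

FCN : ℕ → SimpleGraph
FCN l = record
  { Vertex     = String l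
  ; Adj        = SymClosure (Edge l)
  ; adj-sym    = symmetric (Edge l)
  ; adj-irrefl = λ { (fwd e) → edge⇒≢ e refl ; (bwd e) → edge⇒≢ e refl }
  }

-- In each of the four copies of the 4-cycle the vertices 00 and 11 are twins, so a
-- resolving set contains one of them, and 00 can only be dominated by 01 or 10. Hence
-- every copy contains at least two chosen vertices. Conversely, choosing 00 and 10 in
-- every copy suffices.
{-# OPTIONS --safe #-}
module Submission where

open import Defs
open import Data.Bool.Base using (if_then_else_)
open import Data.Digit using (Bit; 0b; 1b)
open import Data.Fin.Base using (Fin; zero; suc; toℕ; combine)
open import Data.Fin.Properties using (_≟_; all?; combine-surjective; injective⇒≤)
open import Data.List.Base using (List; []; _∷_; length; lookup; cartesianProductWith)
import Data.List.Membership.DecPropositional as DecMembership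
open import Data.List.Membership.Propositional using (_∈_; find)
open import Data.List.Relation.Unary.Any using (Any; any?; index)
open import Data.List.Relation.Unary.Any.Properties using (lookup-index)
import Data.List.Relation.Unary.Unique.DecPropositional as DecUnique
open import Data.Nat.Base using (ℕ; zero; suc; _+_; _≤_; ∣_-_∣)
open import Data.Nat.Properties
  using (≤-reflexive; ≤-trans; ≤-antisym; +-mono-≤; _≤?_)
  renaming (_≟_ to _≟ℕ_)
open import Data.Product.Base using (_,_; _×_; ∃-syntax)
open import Data.Sum.Base using (_⊎_; inj₁; inj₂; [_,_])
open import Data.Vec.Base using (Vec; []; _∷_; _++_; sum; zipWith)
open import Data.Vec.Properties using (≡-dec)
open import Function.Base using (_∘_)
open import Relation.Binary.Construct.Closure.Symmetric using (fwd; bwd)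
open import Relation.Binary.Definitions using (DecidableEquality)
open import Relation.Binary.PropositionalEquality
  using (_≡_; _≢_; refl; sym; trans; cong; subst)
open import Relation.Nullary.Decidable
  using (Dec; yes; no; does; map′; from-yes; ¬?; _⊎-dec_)
open import Relation.Nullary.Negation.Core using (contradiction)
open import Relation.Unary using (Pred; Decidable)

open SimpleGraph using (Vertex; Adj)

-- Counting and exhaustive checks

-- Each `i` is sent to the position of a chosen preimage; applying `f` to the entry there recovers
-- `i`, so this is an injection into the positions of `xs`.
length-≥-image : ∀ {A : Set} {n} (f : A → Fin n) (xs : List A) →
                 (∀ i → ∃[ x ] x ∈ xs × f x ≡ i) → n ≤ length xs
length-≥-image f xs onto = injective⇒≤ {f = position} position-injective
  where
  position : _ → Fin (length xs)
  position i = let _ , x∈xs , _ = onto i in index x∈xs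

  f-position : ∀ i → f (lookup xs (position i)) ≡ i
  f-position i = let _ , x∈xs , fx≡i = onto i in
    trans (cong f (sym (lookup-index x∈xs))) fx≡i

  position-injective : ∀ {i j} → position i ≡ position j → i ≡ j
  position-injective {i} {j} eq =
    trans (sym (f-position i)) (trans (cong (f ∘ lookup xs) eq) (f-position j))

-- Lets `from-yes` settle statements about all bit strings by evaluation.
allVec? : ∀ {k n p} {P : Pred (Vec (Fin k) n) p} → Decidable P → Dec (∀ v → P v)
allVec? {n = zero}  P? = map′ (λ { p [] → p }) (λ p → p []) (P? [])
allVec? {n = suc n} P? =
  map′ (λ { p (x ∷ v) → p x v }) (λ p x v → p (x ∷ v))
       (all? λ x → allVec? λ v → P? (x ∷ v))

_≟ᵛ_ : ∀ {n} → DecidableEquality (Vec Bit n)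
_≟ᵛ_ = ≡-dec _≟_

-- Walks and distances

module _ {Γ : SimpleGraph} where

  infixr 5 _++ʷ_

  _++ʷ_ : ∀ {u v w m n} → Walk Γ u v m → Walk Γ v w n → Walk Γ u w (m + n)
  []      ++ʷ q = q
  (e ∷ p) ++ʷ q = e ∷ (p ++ʷ q)

  IsDistance-unique : ∀ {u v m n} → IsDistance Γ u v m → IsDistance Γ u v n → m ≡ n
  IsDistance-unique (p , p-min) (q , q-min) = ≤-antisym (p-min q) (q-min p)

  module _ (d : Vertex Γ → Vertex Γ → ℕ)
           (d-self : ∀ u → d u u ≡ 0)
           (d-triangle : ∀ u v w → d u w ≤ d u v + d v w)
           (d-adj : ∀ {u v} → Adj Γ u v → d u v ≤ 1) where

    -- Every edge contributes at most 1 by the triangle inequality. This supplies the minimality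
    -- half of `IsDistance` for a guessed distance function.
    metric-≤-walk : ∀ {u v n} → Walk Γ u v n → d u v ≤ n
    metric-≤-walk []      = ≤-reflexive (d-self _)
    metric-≤-walk (e ∷ p) =
      ≤-trans (d-triangle _ _ _) (+-mono-≤ (d-adj e) (metric-≤-walk p))

mapʷ : ∀ {Γ Δ} (f : Vertex Γ → Vertex Δ) → (∀ {u v} → Adj Γ u v → Adj Δ (f u) (f v)) →
       ∀ {u v n} → Walk Γ u v n → Walk Δ (f u) (f v) n
mapʷ f f-adj []      = []
mapʷ f f-adj (e ∷ p) = f-adj e ∷ mapʷ f f-adj p

-- The distance function of FCN(1)

-- On two bits this is the graph distance of the 4-cycle, which is the 2-cube. It serves both inside
-- a copy and for the prefixes of the four copies.
hamming : ∀ {n} → Vec Bit n → Vec Bit n → ℕ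
hamming u v = sum (zipWith (λ a b → ∣ toℕ a - toℕ b ∣) u v)

-- A shortest walk between different copies leaves and enters them through their ports.
distVia : ∀ {p q : Vec Bit 2} → Dec (p ≡ q) → String 0 → String 0 → ℕ
distVia         (yes _) u v = hamming u v
distVia {p} {q} (no _)  u v = hamming u (port 0) + (hamming p q + hamming (port 0) v)

dist : String 1 → String 1 → ℕ
dist (a ∷ b ∷ u) (c ∷ d ∷ v) = distVia ((a ∷ b ∷ []) ≟ᵛ (c ∷ d ∷ [])) u v

walk₀ : ∀ u v → Walk (FCN 0) u v (hamming u v)
walk₀ (a ∷ b ∷ []) (c ∷ d ∷ []) =
  -- Correct the first bit, then the second; `split` only rearranges the final zeros of the sums.
  subst (Walk (FCN 0) _ _) (split a b c d) (flip₁ a c b ++ʷ flip₂ c b d)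
  where
  split : ∀ a b c d → hamming (a ∷ []) (c ∷ []) + hamming (b ∷ []) (d ∷ []) ≡
                      hamming (a ∷ b ∷ []) (c ∷ d ∷ [])
  split = from-yes (all? λ a → all? λ b → all? λ c → all? λ d →
    hamming (a ∷ []) (c ∷ []) + hamming (b ∷ []) (d ∷ []) ≟ℕ
    hamming (a ∷ b ∷ []) (c ∷ d ∷ []))

  flip₁ : ∀ a c b → Walk (FCN 0) (a ∷ b ∷ []) (c ∷ b ∷ []) (hamming (a ∷ []) (c ∷ []))
  flip₁ zero       zero       _          = []
  flip₁ (suc zero) (suc zero) _          = []
  flip₁ zero       (suc zero) zero       = bwd 10-00 ∷ []
  flip₁ zero       (suc zero) (suc zero) = fwd 01-11 ∷ []
  flip₁ (suc zero) zero       zero       = fwd 10-00 ∷ []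
  flip₁ (suc zero) zero       (suc zero) = bwd 01-11 ∷ []

  flip₂ : ∀ c b d → Walk (FCN 0) (c ∷ b ∷ []) (c ∷ d ∷ []) (hamming (b ∷ []) (d ∷ []))
  flip₂ _          zero       zero       = []
  flip₂ _          (suc zero) (suc zero) = []
  flip₂ zero       zero       (suc zero) = fwd 00-01 ∷ []
  flip₂ zero       (suc zero) zero       = bwd 00-01 ∷ []
  flip₂ (suc zero) zero       (suc zero) = bwd 11-10 ∷ []
  flip₂ (suc zero) (suc zero) zero       = fwd 11-10 ∷ []

copy-adj : ∀ {l} a b {u v} → Adj (FCN l) u v → Adj (FCN (suc l)) (a ∷ b ∷ u) (a ∷ b ∷ v)
copy-adj a b (fwd e) = fwd (copy a b e)
copy-adj a b (bwd e) = bwd (copy a b e)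

-- The four ports form a copy of FCN(0) on the prefixes. Its edges are listed in the opposite
-- direction, so `fwd` and `bwd` swap.
port-adj : ∀ {l u v} → Adj (FCN 0) u v → Adj (FCN (suc l)) (u ++ port l) (v ++ port l)
port-adj (fwd 00-01) = bwd 01w-00w
port-adj (fwd 01-11) = bwd 11w-01w
port-adj (fwd 11-10) = bwd 10w-11w
port-adj (fwd 10-00) = bwd 00w-10w
port-adj (bwd 00-01) = fwd 01w-00w
port-adj (bwd 01-11) = fwd 11w-01w
port-adj (bwd 11-10) = fwd 10w-11w
port-adj (bwd 10-00) = fwd 00w-10w

dist-walk : ∀ u v → Walk (FCN 1) u v (dist u v)
dist-walk (a ∷ b ∷ u) (c ∷ d ∷ v) = via ((a ∷ b ∷ []) ≟ᵛ (c ∷ d ∷ []))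
  where
  inCopy : ∀ a b u v → Walk (FCN 1) (a ∷ b ∷ u) (a ∷ b ∷ v) (hamming u v)
  inCopy a b u v = mapʷ (λ w → a ∷ b ∷ w) (copy-adj a b) (walk₀ u v)

  -- Quantifying over the decision lets `distVia` compute in each case.
  via : (eq? : Dec ((a ∷ b ∷ []) ≡ (c ∷ d ∷ []))) →
        Walk (FCN 1) (a ∷ b ∷ u) (c ∷ d ∷ v) (distVia eq? u v)
  via (yes refl) = inCopy a b u v
  via (no _)     =
    inCopy a b u (port 0)
      ++ʷ mapʷ (_++ port 0) port-adj (walk₀ (a ∷ b ∷ []) (c ∷ d ∷ []))
      ++ʷ inCopy c d (port 0) v

dist-self : ∀ u → dist u u ≡ 0
dist-self = from-yes (allVec? λ u → dist u u ≟ℕ 0)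

dist-sym : ∀ u v → dist u v ≡ dist v u
dist-sym = from-yes (allVec? λ u → allVec? λ v → dist u v ≟ℕ dist v u)

dist-triangle : ∀ u v w → dist u w ≤ dist u v + dist v w
dist-triangle =
  from-yes (allVec? λ u → allVec? λ v → allVec? λ w → dist u w ≤? dist u v + dist v w)

-- For variable `a` and `b` the equality test inside `dist` is stuck, so its outcome is analysed by
-- hand.
dist-copy : ∀ a b u v → dist (a ∷ b ∷ u) (a ∷ b ∷ v) ≡ hamming u v
dist-copy a b u v with (a ∷ b ∷ []) ≟ᵛ (a ∷ b ∷ [])
... | yes _  = refl
... | no p≢p = contradiction refl p≢p

dist-edge : ∀ {u v} → Edge 1 u v → dist u v ≡ 1
dist-edge (copy a b 00-01) = dist-copy a b _ _
dist-edge (copy a b 01-11) = dist-copy a b _ _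
dist-edge (copy a b 11-10) = dist-copy a b _ _
dist-edge (copy a b 10-00) = dist-copy a b _ _
dist-edge 00w-10w = refl
dist-edge 10w-11w = refl
dist-edge 11w-01w = refl
dist-edge 01w-00w = refl

dist-adj : ∀ {u v} → Adj (FCN 1) u v → dist u v ≤ 1
dist-adj         (fwd e) = ≤-reflexive (dist-edge e)
dist-adj {u} {v} (bwd e) = ≤-reflexive (trans (dist-sym u v) (dist-edge e))

dist-isDistance : ∀ u v → IsDistance (FCN 1) u v (dist u v)
dist-isDistance u v =
  dist-walk u v , metric-≤-walk {FCN 1} dist dist-self dist-triangle dist-adj

-- Upper bound

chosen : List (String 1)
chosen = cartesianProductWith _++_
  ((0b ∷ 0b ∷ []) ∷ (0b ∷ 1b ∷ []) ∷ (1b ∷ 0b ∷ []) ∷ (1b ∷ 1b ∷ []) ∷ [])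
  ((0b ∷ 0b ∷ []) ∷ (1b ∷ 0b ∷ []) ∷ [])

-- Within a copy, the distances to its 00 and 10 tell all four vertices apart. For different copies
-- the two ports 10 suffice: if neither separated `g` and `h`, each would be farther from its own
-- port than the other is from its own. The disjunction makes the claim decidable, and all pairs are
-- checked.
chosen-separates : ∀ g h → g ≡ h ⊎ Any (λ r → dist g r ≢ dist h r) chosen
chosen-separates = from-yes (allVec? λ g → allVec? λ h →
  (g ≟ᵛ h) ⊎-dec any? (λ r → ¬? (dist g r ≟ℕ dist h r)) chosen)

chosen-resolving : IsResolving (FCN 1) chosen
chosen-resolving {g} {h} g≢h = resolve (chosen-separates g h)
  where
  resolve : g ≡ h ⊎ Any (λ r → dist g r ≢ dist h r) chosen → _
  resolve (inj₁ g≡h) = contradiction g≡h g≢h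
  resolve (inj₂ sep) = let r , r∈chosen , m≢n = find sep in
    r , r∈chosen , _ , _ , dist-isDistance g r , dist-isDistance h r , m≢n

chosen-dominating : IsTotalDominating (FCN 1) chosen
chosen-dominating (a ∷ b ∷ u) = dominator u
  where
  open DecMembership (_≟ᵛ_ {4}) using (_∈?_)

  00∈ : ∀ a b → (a ∷ b ∷ 0b ∷ 0b ∷ []) ∈ chosen
  00∈ = from-yes (all? λ a → all? λ b → (a ∷ b ∷ 0b ∷ 0b ∷ []) ∈? chosen)

  10∈ : ∀ a b → (a ∷ b ∷ 1b ∷ 0b ∷ []) ∈ chosen
  10∈ = from-yes (all? λ a → all? λ b → (a ∷ b ∷ 1b ∷ 0b ∷ []) ∈? chosen)

  dominator : ∀ u → ∃[ v ] v ∈ chosen × Adj (FCN 1) (a ∷ b ∷ u) v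
  dominator (zero     ∷ zero     ∷ []) = _ , 10∈ a b , bwd (copy a b 10-00)
  dominator (zero     ∷ suc zero ∷ []) = _ , 00∈ a b , bwd (copy a b 00-01)
  dominator (suc zero ∷ zero     ∷ []) = _ , 00∈ a b , fwd (copy a b 10-00)
  dominator (suc zero ∷ suc zero ∷ []) = _ , 10∈ a b , fwd (copy a b 11-10)

-- Lower bound

dominating⇒01∨10 : ∀ {R} → IsTotalDominating (FCN 1) R → ∀ a b →
                   (a ∷ b ∷ 0b ∷ 1b ∷ []) ∈ R ⊎ (a ∷ b ∷ 1b ∷ 0b ∷ []) ∈ R
-- The vertex 00 is not a port, so only the two cycle edges at it survive unification.
dominating⇒01∨10 dom a b with dom (a ∷ b ∷ 0b ∷ 0b ∷ [])
... | _ , v∈R , fwd (copy a b 00-01) = inj₁ v∈R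
... | _ , v∈R , bwd (copy a b 10-00) = inj₂ v∈R

-- Both 00 and 11 have exactly the neighbours 01 and 10 of their copy, since neither is the port;
-- every shortest walk to a third vertex starts through these.
twins : ∀ a b r → r ≡ a ∷ b ∷ 0b ∷ 0b ∷ [] ⊎ r ≡ a ∷ b ∷ 1b ∷ 1b ∷ [] ⊎
        dist (a ∷ b ∷ 0b ∷ 0b ∷ []) r ≡ dist (a ∷ b ∷ 1b ∷ 1b ∷ []) r
twins = from-yes (all? λ a → all? λ b → allVec? λ r →
  (r ≟ᵛ (a ∷ b ∷ 0b ∷ 0b ∷ [])) ⊎-dec (r ≟ᵛ (a ∷ b ∷ 1b ∷ 1b ∷ [])) ⊎-dec
  (dist (a ∷ b ∷ 0b ∷ 0b ∷ []) r ≟ℕ dist (a ∷ b ∷ 1b ∷ 1b ∷ []) r))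

resolving⇒00∨11 : ∀ {R} → IsResolving (FCN 1) R → ∀ a b →
                  (a ∷ b ∷ 0b ∷ 0b ∷ []) ∈ R ⊎ (a ∷ b ∷ 1b ∷ 1b ∷ []) ∈ R
resolving⇒00∨11 {R} res a b =
  let r , r∈R , _ , _ , d₀₀ , d₁₁ , m≢n = res {g} {h} (λ ()) in
  twin∈R r∈R d₀₀ d₁₁ m≢n (twins a b r)
  where
  g h : String 1
  g = a ∷ b ∷ 0b ∷ 0b ∷ []
  h = a ∷ b ∷ 1b ∷ 1b ∷ []

  twin∈R : ∀ {r m n} → r ∈ R → IsDistance (FCN 1) g r m → IsDistance (FCN 1) h r n →
           m ≢ n → r ≡ g ⊎ r ≡ h ⊎ dist g r ≡ dist h r → g ∈ R ⊎ h ∈ R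
  twin∈R r∈R _ _ _ (inj₁ r≡g)        = inj₁ (subst (_∈ R) r≡g r∈R)
  twin∈R r∈R _ _ _ (inj₂ (inj₁ r≡h)) = inj₂ (subst (_∈ R) r≡h r∈R)
  -- Uniqueness of distances identifies `m` and `n` with values of `dist`, which agree here.
  twin∈R {r} _ d₀₀ d₁₁ m≢n (inj₂ (inj₂ eq)) = contradiction
    (trans (IsDistance-unique {FCN 1} d₀₀ (dist-isDistance g r))
      (trans eq (IsDistance-unique {FCN 1} (dist-isDistance h r) d₁₁))) m≢n

-- The bipartition of the 4-cycle: 00 and 11 against 01 and 10.
parity : String 0 → Bit
parity (c ∷ d ∷ []) = if does (c ≟ d) then 0b else 1b

-- The twins 00 and 11 of a copy share a class, as do their neighbours 01 and 10.
class : String 1 → Fin 8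
class (a ∷ b ∷ u) = combine a (combine b (parity u))

-- Four copies with two classes each give 8 classes: resolving the twins hits class 0 of a copy, and
-- dominating its vertex 00 hits class 1.
resolvingTotalDominating⇒class-onto :
  ∀ {R} → IsResolvingTotalDominating (FCN 1) R → ∀ i → ∃[ r ] r ∈ R × class r ≡ i
resolvingTotalDominating⇒class-onto {R} (res , dom) i =
  -- Decode `i` into the two prefix bits and the parity, along 8 = 2 * (2 * 2).
  let a , j , eq₁ = combine-surjective {2} {4} i
      b , p , eq₂ = combine-surjective {2} {2} j
      r , r∈R , eq = hit a b p
  in r , r∈R , trans eq (trans (cong (combine a) eq₂) eq₁)
  where
  hit : ∀ a b p → ∃[ r ] r ∈ R × class r ≡ combine a (combine b p)
  hit a b zero       =
    [ (λ r∈R → _ , r∈R , refl) , (λ r∈R → _ , r∈R , refl) ] (resolving⇒00∨11 res a b)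
  hit a b (suc zero) =
    [ (λ r∈R → _ , r∈R , refl) , (λ r∈R → _ , r∈R , refl) ] (dominating⇒01∨10 dom a b)

theorem28 : IsResolvingTotalDominationNumber (FCN 1) 8
theorem28 =
  (chosen , from-yes (DecUnique.unique? _≟ᵛ_ chosen) ,
    ((λ {g} {h} → chosen-resolving {g} {h}) , chosen-dominating) , refl) ,
  λ R _ rtd → length-≥-image class R (resolvingTotalDominating⇒class-onto rtd)
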